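{- Let $r\in\mathbb N$ and let $\mathbb N=C_1\cup\dots\cup C_r$ be a finite colouring. Then there are $m\le r$ and sequences $(x_i)_{i\in\mathbb N}$ and $(y_i)_{i\in\mathbb N}$ of natural numbers such that $$\operatorname{FS}(x_i\mid i\in\mathbb N)\ \cup\ \left\{\frac{\sum_{i\in G}x_i}{\sum_{i\in F}x_i}\ \middle|\ F,G\in\mathcal P_{\mathrm{fin}}(\mathbb N)\setminus\{\emptyset\},\ F<G\right\}\subseteq C_m$$ and $$\left\{\sum_{\ell\in F}\ \prod_{i=k}^{\ell}y_i\ \middle|\ F\in\mathcal P_{\mathrm{fin}}(\mathbb N)\setminus\{\emptyset\},\ k\in\mathbb N,\ k\le\min F\right\}\subseteq C_m.$$ Moreover, if $u\in\beta\mathbb N$ is any additively idempotent ultrafilter, then one may take as $C_m$ the colour belonging to the ultrafilter $D(u\otimes u)$.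
   Context: $\mathbb N$ denotes the set of positive integers ($0\notin\mathbb N$). A finite colouring of $\mathbb N$ is a partition of $\mathbb N$ into finitely many pieces, called colours. $\mathcal P_{\mathrm{fin}}(\mathbb N)$ is the set of finite subsets of $\mathbb N$; for nonempty finite $F,G\subseteq\mathbb N$, $F<G$ means $\max F<\min G$. $\operatorname{FS}(x_i\mid i\in\mathbb N)=\{x_{i_1}+\dots+x_{i_k}\mid k\in\mathbb N,\ i_1<\dots<i_k\}$. The function $D:\mathbb N^2\to\mathbb N$ sends $(x,y)$ to $y/x$ if $x\mid y$ and to $1$ otherwise. $\beta\mathbb N$ is the set of ultrafilters on $\mathbb N$. For $u\in\beta\mathbb N$, $u\otimes u$ is the ultrafilter on $\mathbb N^2$ given by $A\in u\otimes u\iff\{a\mid\{b\mid(a,b)\in A\}\in u\}\in u$. For an ultrafilter $w$ on $\mathbb N^k$ and $f:\mathbb N^k\to\mathbb N$, $f(w)=\{A\subseteq\mathbb N\mid f^{ -1}(A)\in w\}$ is the pushforward. An ultrafilter $u\in\beta\mathbb N$ is additively idempotent if its pushforward identity $u=S(u\otimes u)$ holds, where $S(a,b)=a+b$. -}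

module Defs where

open import Data.Fin.Base using (Fin)
open import Data.Integer.Base as ℤ using ()
open import Data.Irrelevant using ([_])
open import Data.List.NonEmpty.Base as List⁺ using (List⁺; foldr₁; toList)
open import Data.List.Relation.Unary.Linked using (Linked)
open import Data.Nat.Base as ℕ using (ℕ; zero; suc; NonZero; _∸_; z≤n; >-nonZero; >-nonZero⁻¹)
open import Data.Nat.Divisibility using (_∣?_; quotient; quotient≢0)
open import Data.Nat.Properties using (+-mono-≤; m*n≢0; nonZero?)
open import Data.Product.Base using (∃-syntax; _×_; _,_; uncurry)
open import Data.Rational.Base as ℚ using (ℚ)
open import Data.Refinement.Base using (Refinement-syntax; _,_; value)
open import Data.Sum.Base using (_⊎_; inj₁; inj₂)
open import Function.Base using (_on_)
open import Level using (0ℓ)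
open import Relation.Binary.Core using (Rel)
open import Relation.Binary.PropositionalEquality.Core using (_≡_)
open import Relation.Nullary.Decidable.Core using (yes; no; recompute)
open import Relation.Unary using (Pred; _∈_; _∉_; _⊆_; _≐_; _∩_; ∁; U; ∅; _⊢_)

ℕ⁺ : Set
ℕ⁺ = [ n ∈ ℕ ∣ NonZero n ]

positive : (n : ℕ⁺) → NonZero (value n)
positive (n , [ n≢0 ]) = recompute (nonZero? n) n≢0

toℕ⁺ : (n : ℕ) .{{_ : NonZero n}} → ℕ⁺
toℕ⁺ n {{n≢0}} = n , [ n≢0 ]

infix  4 _<_ _≤_
infixl 6 _+_
infixl 7 _*_

_<_ _≤_ : Rel ℕ⁺ 0ℓ
_<_ = ℕ._<_ on value
_≤_ = ℕ._≤_ on value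

suc⁺ : ℕ⁺ → ℕ⁺
suc⁺ n = toℕ⁺ (suc (value n))

_+_ : ℕ⁺ → ℕ⁺ → ℕ⁺
m + n = toℕ⁺ (value m ℕ.+ value n) {{>-nonZero (+-mono-≤ (>-nonZero⁻¹ (value m) {{positive m}}) z≤n)}}

_*_ : ℕ⁺ → ℕ⁺ → ℕ⁺
m * n = toℕ⁺ (value m ℕ.* value n) {{m*n≢0 (value m) (value n) {{positive m}} {{positive n}}}}

D : ℕ⁺ × ℕ⁺ → ℕ⁺
D (x , y) with value x ∣? value y
... | yes x∣y = toℕ⁺ (quotient x∣y) {{quotient≢0 x∣y {{positive y}}}}
... | no  _   = toℕ⁺ 1

-- A nonempty finite subset of ℕ⁺ is given by the list of its elements in
-- increasing order.

record FinSubset⁺ : Set where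
  constructor finSubset⁺
  field
    elements   : List⁺ ℕ⁺
    increasing : Linked _<_ (toList elements)

  min max : ℕ⁺
  min = List⁺.head elements
  max = List⁺.last elements

open FinSubset⁺ public

infix 4 _≺_

_≺_ : Rel FinSubset⁺ 0ℓ
F ≺ G = max F < min G

Sequence : Set
Sequence = ℕ⁺ → ℕ⁺

∑ : FinSubset⁺ → (ℕ⁺ → ℕ⁺) → ℕ⁺
∑ F x = foldr₁ _+_ (List⁺.map x (elements F))

-- productOf y k n = y k * y (k + 1) * ⋯ * y (k + n)

productOf : Sequence → ℕ⁺ → ℕ → ℕ⁺
productOf y k zero    = y k
productOf y k (suc n) = y k * productOf y (suc⁺ k) n

-- The product of y i for k ≤ i ≤ ℓ; only meaningful when k ≤ ℓ.

∏[_⋯_] : ℕ⁺ → ℕ⁺ → Sequence → ℕ⁺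
∏[ k ⋯ ℓ ] y = productOf y k (value ℓ ∸ value k)

FS : Sequence → Pred ℕ⁺ 0ℓ
FS x z = ∃[ F ] z ≡ ∑ F x

-- The quotients need not be integers a priori, so they are taken in ℚ.

_÷_ : ℕ⁺ → ℕ⁺ → ℚ
b ÷ a = (ℤ.+ value b ℚ./ value a) {{positive a}}

Ratios : Sequence → Pred ℚ 0ℓ
Ratios x q = ∃[ F ] ∃[ G ] F ≺ G × q ≡ ∑ G x ÷ ∑ F x

SumsOfProducts : Sequence → Pred ℕ⁺ 0ℓ
SumsOfProducts y z = ∃[ F ] ∃[ k ] k ≤ min F × z ≡ ∑ F (λ ℓ → ∏[ k ⋯ ℓ ] y)

-- The image of a set of positive integers under the inclusion into ℚ.

inℚ : Pred ℕ⁺ 0ℓ → Pred ℚ 0ℓ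
inℚ A q = ∃[ n ] n ∈ A × q ≡ n ÷ toℕ⁺ 1

ContainsPatterns : Pred ℕ⁺ 0ℓ → Set
ContainsPatterns A =
  ∃[ x ] ∃[ y ] (FS x ⊆ A × Ratios x ⊆ inℚ A) × SumsOfProducts y ⊆ A

-- Some of the colours may be empty.

record FiniteColouring (r : ℕ⁺) : Set₁ where
  field
    colour   : Fin (value r) → Pred ℕ⁺ 0ℓ
    covers   : ∀ n → ∃[ m ] n ∈ colour m
    disjoint : ∀ {i j n} → n ∈ colour i → n ∈ colour j → i ≡ j

open FiniteColouring public

-- Taking all predicates at level 0 loses no ultrafilters under excluded middle,
-- which makes a predicate at any level equivalent to one at level 0.

record Ultrafilter (X : Set) : Set₁ where
  field
    sets         : Pred (Pred X 0ℓ) 0ℓ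
    whole        : U ∈ sets
    nonempty     : ∅ ∉ sets
    upward       : ∀ {A B} → A ⊆ B → A ∈ sets → B ∈ sets
    intersection : ∀ {A B} → A ∈ sets → B ∈ sets → (A ∩ B) ∈ sets
    ultra        : ∀ A → A ∈ sets ⊎ ∁ A ∈ sets

open Ultrafilter public

pushforward : {X Y : Set} → (X → Y) → Ultrafilter X → Ultrafilter Y
pushforward f w = record
  { sets         = λ A → (f ⊢ A) ∈ sets w
  ; whole        = whole w
  ; nonempty     = nonempty w
  ; upward       = λ A⊆B → upward w A⊆B
  ; intersection = intersection w
  ; ultra        = λ A → ultra w (f ⊢ A)
  }

infixr 7 _⊗_

_⊗_ : {X Y : Set} → Ultrafilter X → Ultrafilter Y → Ultrafilter (X × Y)
u ⊗ v = record
  { sets         = λ A → (λ a → (λ b → (a , b) ∈ A) ∈ sets v) ∈ sets u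
  ; whole        = upward u (λ _ → whole v) (whole u)
  ; nonempty     = λ p → nonempty u (upward u (nonempty v) p)
  ; upward       = λ A⊆B → upward u (upward v A⊆B)
  ; intersection = λ p q → upward u (uncurry (intersection v)) (intersection u p q)
  ; ultra        = λ A → ultra-⊗ A (ultra u (λ a → (λ b → (a , b) ∈ A) ∈ sets v))
  }
  where
  ultra-⊗ : ∀ A → let S = λ a → (λ b → (a , b) ∈ A) ∈ sets v in
            S ∈ sets u ⊎ ∁ S ∈ sets u →
            S ∈ sets u ⊎ (λ a → (λ b → (a , b) ∈ ∁ A) ∈ sets v) ∈ sets u
  ultra-⊗ A (inj₁ p) = inj₁ p
  ultra-⊗ A (inj₂ p) = inj₂ (upward u (λ {a} → step a) p)
    where
    step : ∀ a → ((λ b → (a , b) ∈ A) ∉ sets v) → (λ b → (a , b) ∈ ∁ A) ∈ sets v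
    step a ∉v with ultra v (λ b → (a , b) ∈ A)
    ... | inj₁ q with () ← ∉v q
    ... | inj₂ q = q

AdditivelyIdempotent : Ultrafilter ℕ⁺ → Set₁
AdditivelyIdempotent u = sets u ≐ sets (pushforward (uncurry _+_) (u ⊗ u))

{-# OPTIONS --safe #-}

-- Call a filter idempotent if A ∈ F implies {a : {b : a + b ∈ A} ∈ F} ∈ F. If F
-- also contains all sets aℕ and {a : {b : D(a,b) ∈ A} ∈ F} ∈ F, then so does the
-- set of those s for which {t : t/s ∈ A} ∈ F. Fix one such a₀. As in the
-- Galvin–Glazer proof of Hindman's theorem one picks z₁, z₂, … successively so
-- that all finite sums s of the zᵢ are among these s, s/a₀ ∈ A, and every later
-- sum t has t/s ∈ A. Then xᵢ = zᵢ/a₀ and yᵢ = zᵢ₊₁/zᵢ work, the second because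
-- the product of yᵢ for k ≤ i ≤ ℓ telescopes to z_{ℓ+1}/z_k.
--
-- An idempotent ultrafilter is such an F. For the first claim no ultrafilter is
-- needed (nor available: Zorn's lemma wants a choice function that respects
-- extensional equality of sets). A filter with a countable base of sets
-- B₀ ⊇ B₁ ⊇ … such that every a ∈ Bₙ has a + Bₘ ⊆ Bₙ for some m is idempotent, and
-- Baumgartner's proof of Hindman's theorem refines such a base into one colour.
-- Iterating and diagonalising decides the colour c(a) of D(a,b) for every a, and
-- one more refinement makes c constant.

module Submission where

open import Axiom.ExcludedMiddle using (ExcludedMiddle)
open import Defs
open import Data.Product.Base using (∃-syntax; _×_)
open import Relation.Unary using (_∈_)

open import Data.Empty using (⊥-elim)
open import Data.Fin.Base using (Fin; zero; suc; toℕ)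
open import Data.Fin.Properties using (toℕ-fromℕ<)
open import Data.Integer.Base as ℤ using ()
import Data.Integer.Properties as ℤ
open import Data.Irrelevant using ([_])
open import Data.List.Base using ([]; _∷_; initLast; _∷ʳ′_)
open import Data.List.NonEmpty.Base as List⁺ using (foldr₁; _∷_)
open import Data.List.Relation.Unary.Linked using (Linked; _∷_)
open import Data.Nat.Base as ℕ using (ℕ; zero; suc; NonZero; _!; >-nonZero⁻¹)
open import Data.Nat.Divisibility
  using (_∣_; divides; _∣?_; ∣m∣n⇒∣m+n; ∣m+n∣m⇒∣n; n∣m*n; m≤n⇒m!∣n!; m∣m*n; ∣-trans)
open import Data.Nat.DivMod using (_mod_; _/_; m≡m%n+[m/n]*n; m%n<n)
import Data.Nat.Properties as ℕ
open import Data.Product.Base using (_,_; proj₁; proj₂)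
open import Data.Rational.Properties using (fromℚᵘ-cong)
open import Data.Rational.Unnormalised.Base using (mkℚᵘ; *≡*)
open import Data.Refinement.Base using (_,_; value)
open import Data.Sum.Base using (_⊎_; inj₁; inj₂)
open import Level using (0ℓ) renaming (suc to lsuc)
open import Relation.Binary.Core using (Rel)
open import Relation.Binary.PropositionalEquality
  using (_≡_; refl; sym; trans; cong; cong₂; subst; module ≡-Reasoning)
open import Relation.Nullary using (yes; no; contradiction)
open import Relation.Unary using (Pred; _∉_; _⊆_; _∩_; ∁; U)

-- Arithmetic of positive integers.

value-injective : ∀ {m n : ℕ⁺} → value m ≡ value n → m ≡ n
value-injective {_ , [ _ ]} {_ , [ _ ]} refl = refl

+-assoc : ∀ a b c → (a + b) + c ≡ a + (b + c)
+-assoc a b c = value-injective (ℕ.+-assoc (value a) (value b) (value c))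

*-assoc : ∀ a b c → (a * b) * c ≡ a * (b * c)
*-assoc a b c = value-injective (ℕ.*-assoc (value a) (value b) (value c))

*-comm : ∀ a b → a * b ≡ b * a
*-comm a b = value-injective (ℕ.*-comm (value a) (value b))

*-distribʳ-+ : ∀ c a b → (a + b) * c ≡ a * c + b * c
*-distribʳ-+ c a b = value-injective (ℕ.*-distribʳ-+ (value c) (value a) (value b))

*-cancelʳ-≡ : ∀ a b c → a * c ≡ b * c → a ≡ b
*-cancelʳ-≡ a b c eq =
  value-injective (ℕ.*-cancelʳ-≡ (value a) (value b) (value c) {{positive c}} (cong value eq))

≤-suc-case : ∀ {m n} → m ℕ.≤ suc n → m ℕ.≤ n ⊎ m ≡ suc n
≤-suc-case m≤1+n with ℕ.m≤n⇒m<n∨m≡n m≤1+n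
... | inj₁ m<1+n = inj₁ (ℕ.s≤s⁻¹ m<1+n)
... | inj₂ eq    = inj₂ eq

⊆-antitone : ∀ {X : Set} (S : ℕ → Pred X 0ℓ) → (∀ n → S (suc n) ⊆ S n) →
             ∀ {m n} → m ℕ.≤ n → S n ⊆ S m
⊆-antitone S step {m} {zero}  ℕ.z≤n s∈S = s∈S
⊆-antitone S step {m} {suc n} m≤1+n s∈S with ≤-suc-case m≤1+n
... | inj₁ m≤n  = ⊆-antitone S step m≤n (step n s∈S)
... | inj₂ refl = s∈S

-- Sums over windows of indices.

-- Sums e m n s: s is the sum of e i over a nonempty set of indices m ≤ i < n.

data Sums (e : ℕ → ℕ⁺) : ℕ → ℕ → Pred ℕ⁺ 0ℓ where
  here  : ∀ {n} → Sums e n (suc n) (e n)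
  skipˡ : ∀ {m n s} → Sums e (suc m) n s → Sums e m n s
  skipʳ : ∀ {m n s} → Sums e m n s → Sums e m (suc n) s
  take  : ∀ {m n s} → Sums e (suc m) n s → Sums e m n (e m + s)

module _ {e : ℕ → ℕ⁺} where

  Sums-+ : ∀ {l m n s t} → Sums e l m s → Sums e m n t → Sums e l n (s + t)
  Sums-+ here      q = take q
  Sums-+ (skipˡ p) q = skipˡ (Sums-+ p q)
  Sums-+ (skipʳ p) q = Sums-+ p (skipˡ q)
  Sums-+ {l} {m} {n} {t = t} (take {s = s} p) q =
    subst (Sums e l n) (sym (+-assoc (e l) s t)) (take (Sums-+ p q))

  Sums-monoˡ : ∀ {l m n s} → l ℕ.≤ m → Sums e m n s → Sums e l n s
  Sums-monoˡ {n = n} l≤m = ⊆-antitone (λ l → Sums e l n) (λ _ → skipˡ) l≤m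

  module _ (Y : ℕ → Pred ℕ⁺ 0ℓ) (Y-anti : ∀ n → Y (suc n) ⊆ Y n)
           (Y-shift : ∀ n {t} → t ∈ Y (suc n) → e n + t ∈ Y n) where

    -- The term of smallest index is added last: the remaining sum is by then in `Y (suc m)`, so
    -- shifts by a single term suffice, here and in `Sums⊆`.
    Sums-shift : ∀ {m n s t} → Sums e m n s → t ∈ Y n → s + t ∈ Y m
    Sums-shift here      t∈Y = Y-shift _ t∈Y
    Sums-shift (skipˡ p) t∈Y = Y-anti _ (Sums-shift p t∈Y)
    Sums-shift (skipʳ p) t∈Y = Sums-shift p (Y-anti _ t∈Y)
    Sums-shift {m} {t = t} (take {s = s} p) t∈Y =
      subst (_∈ Y m) (sym (+-assoc (e m) s t)) (Y-shift m (Sums-shift p t∈Y))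

    Sums⊆ : (∀ n → e n ∈ Y n) → ∀ {m n} → Sums e m n ⊆ Y m
    Sums⊆ e∈Y here      = e∈Y _
    Sums⊆ e∈Y (skipˡ p) = Y-anti _ (Sums⊆ e∈Y p)
    Sums⊆ e∈Y (skipʳ p) = Sums⊆ e∈Y p
    Sums⊆ e∈Y (take p)  = Y-shift _ (Sums⊆ e∈Y p)

  -- Up to a constant, `k` lists the partial sums of `e`, and omitting terms of a window only
  -- decreases its total.
  Sums-bounded : (k : ℕ → ℕ) → (∀ n → k (suc n) ≡ k n ℕ.+ value (e n)) →
                 ∀ {m n s} → Sums e m n s → k m ℕ.+ value s ℕ.≤ k n
  Sums-bounded k k-suc {m} here      = ℕ.≤-reflexive (sym (k-suc m))
  Sums-bounded k k-suc {m} (skipˡ {s = s} p) =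
    ℕ.≤-trans (ℕ.+-monoˡ-≤ (value s) (subst (k m ℕ.≤_) (sym (k-suc m)) (ℕ.m≤m+n _ _)))
              (Sums-bounded k k-suc p)
  Sums-bounded k k-suc (skipʳ {n = n} p) =
    ℕ.≤-trans (Sums-bounded k k-suc p) (subst (k n ℕ.≤_) (sym (k-suc n)) (ℕ.m≤m+n _ _))
  Sums-bounded k k-suc {m} {n} (take {s = s} p) = begin
    k m ℕ.+ (value (e m) ℕ.+ value s) ≡⟨ ℕ.+-assoc (k m) (value (e m)) (value s) ⟨
    (k m ℕ.+ value (e m)) ℕ.+ value s ≡⟨ cong (ℕ._+ value s) (k-suc m) ⟨
    k (suc m) ℕ.+ value s             ≤⟨ Sums-bounded k k-suc p ⟩
    k n                               ∎
    where open ℕ.≤-Reasoning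

last-∷∷ : ∀ {A : Set} (x y : A) ys → List⁺.last (x ∷ y ∷ ys) ≡ List⁺.last (y ∷ ys)
last-∷∷ x y ys with initLast ys
... | []       = refl
... | _ ∷ʳ′ _  = refl

-- The reindexing `g` is `value` for sums of the `x i`, and its successor for sums of products,
-- whose telescoped terms carry the index `ℓ + 1`.
∑-Sums : ∀ (e : ℕ → ℕ⁺) (g : ℕ⁺ → ℕ) → (∀ {i j} → i < j → g i ℕ.< g j) →
         ∀ F → Sums e (g (min F)) (suc (g (max F))) (∑ F (λ i → e (g i)))
∑-Sums e g g-mono (finSubset⁺ (i ∷ is) inc) = go i is inc
  where
  go : ∀ i is → Linked _<_ (i ∷ is) →
       Sums e (g i) (suc (g (List⁺.last (i ∷ is))))
            (foldr₁ _+_ (List⁺.map (λ i → e (g i)) (i ∷ is)))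
  go i []       _           = here
  go i (j ∷ is) (i<j ∷ inc)
    rewrite last-∷∷ i j is = take (Sums-monoˡ (g-mono i<j) (go j is inc))

∑-*-distribʳ : ∀ (f h : ℕ⁺ → ℕ⁺) c k F → k ≤ min F →
               (∀ i → k ≤ i → f i ≡ h i * c) → ∑ F f ≡ ∑ F h * c
∑-*-distribʳ f h c k (finSubset⁺ (i ∷ is) inc) k≤i f≡h*c = go i is inc k≤i
  where
  go : ∀ i is → Linked _<_ (i ∷ is) → k ≤ i →
       foldr₁ _+_ (List⁺.map f (i ∷ is)) ≡ foldr₁ _+_ (List⁺.map h (i ∷ is)) * c
  go i []       _           k≤i = f≡h*c i k≤i
  go i (j ∷ is) (i<j ∷ inc) k≤i =
    trans (cong₂ _+_ (f≡h*c i k≤i) (go j is inc (ℕ.≤-trans k≤i (ℕ.<⇒≤ i<j))))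
          (sym (*-distribʳ-+ c (h i) (foldr₁ _+_ (List⁺.map h (j ∷ is)))))

productOf-telescopes : ∀ (y : Sequence) (z : ℕ → ℕ⁺) →
  (∀ i → z (suc (value i)) ≡ y i * z (value i)) →
  ∀ n k → z (suc (n ℕ.+ value k)) ≡ productOf y k n * z (value k)
productOf-telescopes y z z-suc zero    k = z-suc k
productOf-telescopes y z z-suc (suc n) k = begin
  z (suc (suc n ℕ.+ value k))              ≡⟨ cong (λ i → z (suc i)) (ℕ.+-suc n (value k)) ⟨
  z (suc (n ℕ.+ suc (value k)))            ≡⟨ productOf-telescopes y z z-suc n (suc⁺ k) ⟩
  P * z (suc (value k))                    ≡⟨ cong (P *_) (z-suc k) ⟩
  P * (y k * z (value k))                  ≡⟨ *-assoc P (y k) (z (value k)) ⟨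
  (P * y k) * z (value k)                  ≡⟨ cong (_* z (value k)) (*-comm P (y k)) ⟩
  (y k * P) * z (value k)                  ∎
  where
  open ≡-Reasoning
  P = productOf y (suc⁺ k) n

÷-multiple : ∀ t q s → t ≡ q * s → t ÷ s ≡ q ÷ toℕ⁺ 1
÷-multiple _ (q , _) (suc s , _) refl = fromℚᵘ-cong {mkℚᵘ (ℤ.+ (q ℕ.* suc s)) s} {mkℚᵘ (ℤ.+ q) 0}
  (*≡* (trans (ℤ.*-identityʳ _) (ℤ.pos-* q (suc s))))
÷-multiple _ _ (zero , [ () ])

-- Idempotent filters and quotients.

record IdempotentFilter : Set₁ where
  field
    members    : Pred (Pred ℕ⁺ 0ℓ) 0ℓ
    total      : U ∈ members
    inhabited  : ∀ {A} → A ∈ members → ∃[ a ] a ∈ A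
    superset   : ∀ {A B} → A ⊆ B → A ∈ members → B ∈ members
    meet       : ∀ {A B} → A ∈ members → B ∈ members → (A ∩ B) ∈ members
    idempotent : ∀ {A} → A ∈ members → (λ a → (λ b → a + b ∈ A) ∈ members) ∈ members

Multiple : Pred ℕ⁺ 0ℓ → ℕ⁺ → Pred ℕ⁺ 0ℓ
Multiple A s t = ∃[ q ] q ∈ A × t ≡ q * s

-- Divisibility rules out the default value 1 of `D`, so the member of `A` is a genuine quotient.
D-Multiple : ∀ A a b → value a ∣ value b → D (a , b) ∈ A → Multiple A a b
D-Multiple A a b a∣b D∈A with value a ∣? value b
... | yes (divides q eq) = _ , D∈A , value-injective eq
... | no  a∤b            = contradiction a∣b a∤b

-- The sequences `x` and `y` read off from `e`.

module _ (A : Pred ℕ⁺ 0ℓ) (e : ℕ → ℕ⁺) (a₀ : ℕ⁺)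
         (multiple : ∀ {m n s} → Sums e m n s → Multiple A a₀ s)
         (ratio : ∀ {l m n s t} → Sums e l m s → Sums e m n t → Multiple A s t) where

  private
    x y : Sequence
    x i = proj₁ (multiple (here {e} {value i}))
    y i = proj₁ (ratio (here {e} {value i}) here)

    e≡x*a₀ : ∀ i → e (value i) ≡ x i * a₀
    e≡x*a₀ i = proj₂ (proj₂ (multiple (here {e} {value i})))

    e-suc : ∀ i → e (suc (value i)) ≡ y i * e (value i)
    e-suc i = proj₂ (proj₂ (ratio (here {e} {value i}) here))

    ∑e : FinSubset⁺ → ℕ⁺
    ∑e F = ∑ F (λ i → e (value i))

    ∑e-Sums : ∀ F → Sums e (value (min F)) (suc (value (max F))) (∑e F)
    ∑e-Sums = ∑-Sums e value (λ i<j → i<j)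

    ∑e≡∑x*a₀ : ∀ F → ∑e F ≡ ∑ F x * a₀
    ∑e≡∑x*a₀ F = ∑-*-distribʳ _ x a₀ (toℕ⁺ 1) F
      (>-nonZero⁻¹ _ {{positive (min F)}}) (λ i _ → e≡x*a₀ i)

    FSx⊆A : FS x ⊆ A
    FSx⊆A (F , refl) with multiple (∑e-Sums F)
    ... | q , q∈A , eq =
      subst (_∈ A) (*-cancelʳ-≡ _ _ a₀ (trans (sym eq) (∑e≡∑x*a₀ F))) q∈A

    Ratios⊆A : Ratios x ⊆ inℚ A
    Ratios⊆A (F , G , F≺G , eq) =
      q , q∈A , trans eq (÷-multiple (∑ G x) q (∑ F x) (*-cancelʳ-≡ _ _ a₀ (begin
        ∑ G x * a₀        ≡⟨ ∑e≡∑x*a₀ G ⟨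
        ∑e G              ≡⟨ t≡q*s ⟩
        q * ∑e F          ≡⟨ cong (q *_) (∑e≡∑x*a₀ F) ⟩
        q * (∑ F x * a₀)  ≡⟨ *-assoc q (∑ F x) a₀ ⟨
        (q * ∑ F x) * a₀  ∎)))
      where
      open ≡-Reasoning
      quotient : Multiple A (∑e F) (∑e G)
      -- `F ≺ G` unfolds to the inequality that lets the window of `G` be extended down to the end
      -- `suc (max F)` of the window of `F`.
      quotient = ratio (∑e-Sums F) (Sums-monoˡ F≺G (∑e-Sums G))
      q     = proj₁ quotient
      q∈A   = proj₁ (proj₂ quotient)
      t≡q*s = proj₂ (proj₂ quotient)

    -- Multiplication by `e k` turns the product up to `ℓ` into `e (ℓ + 1)`, hence the whole into a
    -- sum of terms with indices past `k`, whose ratio to `e k` lies in `A`.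
    SumsOfProducts⊆A : SumsOfProducts y ⊆ A
    SumsOfProducts⊆A (F , k , k≤F , refl)
      with ratio (here {e} {value k})
             (Sums-monoˡ (ℕ.s≤s k≤F) (∑-Sums e (λ i → suc (value i)) ℕ.s≤s F))
    ... | q , q∈A , eq = subst (_∈ A) (*-cancelʳ-≡ _ _ (e (value k)) (trans (sym eq)
            (∑-*-distribʳ _ (λ ℓ → ∏[ k ⋯ ℓ ] y) (e (value k)) k F k≤F telescope))) q∈A
      where
      telescope : ∀ i → k ≤ i → e (suc (value i)) ≡ ∏[ k ⋯ i ] y * e (value k)
      telescope i k≤i = trans (cong (λ n → e (suc n)) (sym (ℕ.m∸n+n≡m k≤i)))
                              (productOf-telescopes y e e-suc _ k)

  ratios⇒ContainsPatterns : ContainsPatterns A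
  ratios⇒ContainsPatterns =
    x , y , ((λ {s} → FSx⊆A {s}) , (λ {s} → Ratios⊆A {s})) , λ {s} → SumsOfProducts⊆A {s}

module _ (em : ∀ ℓ → ExcludedMiddle ℓ) where

  -- The Galvin-Glazer construction in an idempotent filter.

  module _ (F : IdempotentFilter)
           (multiples : ∀ (a : ℕ⁺) → (λ b → value a ∣ value b) ∈ IdempotentFilter.members F)
           (A : Pred ℕ⁺ 0ℓ)
           (A∈D : (λ a → (λ b → D (a , b) ∈ A) ∈ IdempotentFilter.members F)
                  ∈ IdempotentFilter.members F) where

    open IdempotentFilter F

    private
      Divisor : Pred ℕ⁺ 0ℓ
      Divisor s = Multiple A s ∈ members

      Divisor∈ : Divisor ∈ members
      Divisor∈ = superset
        (λ {a} D∈A → superset (λ {b} (a∣b , D∈A) → D-Multiple A a b a∣b D∈A) (meet (multiples a) D∈A))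
        A∈D

      -- The bound `k` leaves finitely many conditions, so that their intersection stays in the
      -- filter.
      Divisible : ℕ → Pred ℕ⁺ 0ℓ
      Divisible k t = ∀ s → value s ℕ.≤ k → s ∈ Divisor → Multiple A s t

      Divisible∈ : ∀ k → Divisible k ∈ members
      Divisible∈ zero    = superset (λ _ s s≤0 → contradiction s≤0 (ℕ.<⇒≱ (>-nonZero⁻¹ _ {{positive s}}))) total
      Divisible∈ (suc k) with em 0ℓ {toℕ⁺ (suc k) ∈ Divisor}
      ... | no  ∉D = superset extend (Divisible∈ k)
        where
        extend : Divisible k ⊆ Divisible (suc k)
        extend t∈ s s≤ s∈D with ≤-suc-case s≤
        ... | inj₁ s≤k = t∈ s s≤k s∈D
        ... | inj₂ eq  = contradiction (subst (_∈ Divisor) (value-injective {s} {toℕ⁺ (suc k)} eq) s∈D) ∉D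
      ... | yes ∈D = superset extend (meet (Divisible∈ k) ∈D)
        where
        extend : (Divisible k ∩ Multiple A (toℕ⁺ (suc k))) ⊆ Divisible (suc k)
        extend {t} (t∈ , t∈M) s s≤ s∈D with ≤-suc-case s≤
        ... | inj₁ s≤k = t∈ s s≤k s∈D
        ... | inj₂ eq  = subst (λ s → Multiple A s t) (sym (value-injective {s} {toℕ⁺ (suc k)} eq)) t∈M

      a₀ : ℕ⁺
      a₀ = proj₁ (inhabited Divisor∈)

      record Stage : Set₁ where
        field
          W         : Pred ℕ⁺ 0ℓ
          W∈        : W ∈ members
          bound     : ℕ
          divisible : W ⊆ Divisible bound

        chosen : ∃[ z ] z ∈ W × (λ t → z + t ∈ W) ∈ members
        chosen = inhabited (meet W∈ (idempotent W∈))

        z : ℕ⁺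
        z = proj₁ chosen

      open Stage

      next : Stage → Stage
      next S = record
        { W         = W S ∩ (λ t → z S + t ∈ W S) ∩ Divisible k
        ; W∈        = meet (W∈ S) (meet (proj₂ (proj₂ (chosen S))) (Divisible∈ k))
        ; bound     = k
        ; divisible = λ (_ , _ , t∈) → t∈
        }
        -- Along the stages this is the total of all terms chosen so far, hence at least every sum
        -- of them.
        where k = bound S ℕ.+ value (z S)

      stage : ℕ → Stage
      stage zero    = record
        -- `Divisor` makes every sum a possible denominator for later sums; `Multiple A a₀` makes
        -- its quotient by `a₀` lie in `A`.
        { W         = Divisor ∩ Multiple A a₀ ∩ Divisible 0
        ; W∈        = meet Divisor∈ (meet (proj₂ (inhabited Divisor∈)) (Divisible∈ 0))
        ; bound     = 0
        ; divisible = λ (_ , _ , t∈) → t∈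
        }
      stage (suc n) = next (stage n)

      e : ℕ → ℕ⁺
      e n = z (stage n)

      Sums⊆W : ∀ {m n} → Sums e m n ⊆ W (stage m)
      Sums⊆W = Sums⊆ (λ n → W (stage n)) (λ _ → proj₁) (λ _ (_ , t∈ , _) → t∈)
                     (λ n → proj₁ (proj₂ (chosen (stage n))))

      Sums⊆W₀ : ∀ {m n} → Sums e m n ⊆ W (stage 0)
      Sums⊆W₀ {m} p = ⊆-antitone (λ n → W (stage n)) (λ _ → proj₁) {n = m} ℕ.z≤n (Sums⊆W p)

      -- The terms of `s` are chosen before stage `m`, so `s` is within the bound of that stage, and
      -- `W (stage m)` contains `t`.
      ratio : ∀ {l m n s t} → Sums e l m s → Sums e m n t → Multiple A s t
      ratio {l} {m} {s = s} p q = divisible (stage m) (Sums⊆W q) s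
        (ℕ.≤-trans (ℕ.m≤n+m (value s) (bound (stage l)))
                   (Sums-bounded (λ n → bound (stage n)) (λ _ → refl) p))
        (proj₁ (Sums⊆W₀ p))

    D-member⇒ContainsPatterns : ContainsPatterns A
    D-member⇒ContainsPatterns =
      ratios⇒ContainsPatterns A e a₀ (λ p → proj₁ (proj₂ (Sums⊆W₀ p))) ratio

  -- Countable bases and large sets.

  record IdempotentBase : Set₁ where
    field
      B       : ℕ → Pred ℕ⁺ 0ℓ
      element : ∀ n → ∃[ a ] a ∈ B n
      shrink  : ∀ n → B (suc n) ⊆ B n
      absorb  : ∀ {n a} → a ∈ B n → ∃[ m ] (∀ {b} → b ∈ B m → a + b ∈ B n)

    B-mono : ∀ {m n} → m ℕ.≤ n → B n ⊆ B m
    B-mono = ⊆-antitone B shrink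

  open IdempotentBase

  infix 4 _⊑_

  -- Comparing level by level, rather than comparing generated filters, keeps the diagonal in `fuse`
  -- decreasing.
  _⊑_ : Rel IdempotentBase 0ℓ
  q ⊑ p = ∀ n → B q n ⊆ B p n

  ⊑-refl : ∀ {p} → p ⊑ p
  ⊑-refl n b∈B = b∈B

  ⊑-trans : ∀ {p q r} → p ⊑ q → q ⊑ r → p ⊑ r
  ⊑-trans p⊑q q⊑r n b∈B = q⊑r n (p⊑q n b∈B)

  drop : ℕ → IdempotentBase → IdempotentBase
  drop k p = record
    { B       = λ n → B p (k ℕ.+ n)
    ; element = λ n → element p (k ℕ.+ n)
    ; shrink  = λ n → B-mono p (ℕ.+-monoʳ-≤ k (ℕ.n≤1+n n))
    ; absorb  = λ a∈B → let m , a+B⊆B = absorb p a∈B in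
                m , λ b∈B → a+B⊆B (B-mono p (ℕ.m≤n+m m k) b∈B)
    }

  drop-⊑ : ∀ k p → drop k p ⊑ p
  drop-⊑ k p n = B-mono p (ℕ.m≤n+m n k)

  -- Testing level 0 is enough: `drop k q` refines `p` as well, so a large set meets every level of
  -- every refinement.
  Large : IdempotentBase → Pred ℕ⁺ 0ℓ → Set₁
  Large p A = ∀ q → q ⊑ p → ∃[ b ] b ∈ B q 0 × b ∈ A

  Large-⊑ : ∀ {p q A} → q ⊑ p → Large p A → Large q A
  Large-⊑ {p} {q} q⊑p large r r⊑q = large r (⊑-trans {r} {q} {p} r⊑q q⊑p)

  large⊎avoidable : ∀ p A → Large p A ⊎ (∃[ q ] q ⊑ p × (∀ {b} → b ∈ B q 0 → b ∉ A))
  large⊎avoidable p A with em (lsuc 0ℓ) {∃[ q ] q ⊑ p × (∀ {b} → b ∈ B q 0 → b ∉ A)}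
  ... | yes avoidable = inj₂ avoidable
  ... | no  ¬avoidable = inj₁ large
    where
    large : Large p A
    large q q⊑p with em 0ℓ {∃[ b ] b ∈ B q 0 × b ∈ A}
    ... | yes meets = meets
    ... | no  ¬meets = ⊥-elim (¬avoidable (q , q⊑p , λ b∈B b∈A → ¬meets (_ , b∈B , b∈A)))

  -- A colour that is not large is avoided by a refinement, which leaves one colour fewer; the
  -- colours cannot run out because level 0 has an element.
  large-pigeonhole : ∀ k p (P : Fin k → Pred ℕ⁺ 0ℓ) → (∀ {b} → b ∈ B p 0 → ∃[ i ] b ∈ P i) →
                     ∃[ q ] ∃[ i ] q ⊑ p × Large q (P i)
  large-pigeonhole zero    p P covers with covers (proj₂ (element p 0))
  ... | () , _
  large-pigeonhole (suc k) p P covers with large⊎avoidable p (P zero)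
  ... | inj₁ large = p , zero , ⊑-refl {p} , large
  ... | inj₂ (q , q⊑p , avoids) =
    let r , i , r⊑q , large = large-pigeonhole k q (λ i → P (suc i)) rest in
    r , suc i , ⊑-trans {r} {q} {p} r⊑q q⊑p , large
    where
    rest : ∀ {b} → b ∈ B q 0 → ∃[ i ] b ∈ P (suc i)
    rest b∈B with covers (q⊑p 0 b∈B)
    ... | zero  , b∈P = contradiction b∈P (avoids b∈B)
    ... | suc i , b∈P = i , b∈P

  -- If every translate failed, then A would be avoided by the sums a + d with
  -- d ∈ A so far out that e + d ∉ A for all e ≤ n + a. Since s + (a + d) is
  -- (s + a) + d, these sums absorb each other as soon as n is at least s.

  large-translate : ∀ p A → Large p A →
    ∃[ e ] e ∈ B p 0 × (∃[ q ] q ⊑ p × Large q (A ∩ (λ t → e + t ∈ A)))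
  large-translate p A large with em (lsuc 0ℓ)
    {∃[ e ] e ∈ B p 0 × (∃[ q ] q ⊑ p × Large q (A ∩ (λ t → e + t ∈ A)))}
  ... | yes found = found
  ... | no  ¬found = let _ , s∈R , s∈A = large R (λ n → proj₁) in ⊥-elim (R-avoids s∈R s∈A)
    where
    Escapes : ℕ → Pred ℕ⁺ 0ℓ
    Escapes k d = ∀ e → value e ℕ.≤ k → e ∈ B p 0 → e + d ∉ A

    refine : ∀ k q → q ⊑ p →
             ∃[ r ] r ⊑ q × (∀ {d} → d ∈ B r 0 → d ∈ A → d ∈ Escapes k)
    refine zero q q⊑p = q , ⊑-refl {q} , λ _ _ e e≤0 →
      contradiction e≤0 (ℕ.<⇒≱ (>-nonZero⁻¹ _ {{positive e}}))
    refine (suc k) q q⊑p with refine k q q⊑p | em 0ℓ {toℕ⁺ (suc k) ∈ B p 0}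
    ... | r , r⊑q , escapes | no ∉B = r , r⊑q , escapes′
      where
      escapes′ : ∀ {d} → d ∈ B r 0 → d ∈ A → d ∈ Escapes (suc k)
      escapes′ d∈B d∈A e e≤ e∈B with ≤-suc-case e≤
      ... | inj₁ e≤k = escapes d∈B d∈A e e≤k e∈B
      ... | inj₂ eq  = contradiction (subst (_∈ B p 0) (value-injective {e} {toℕ⁺ (suc k)} eq) e∈B) ∉B
    ... | r , r⊑q , escapes | yes ∈B
      with large⊎avoidable r (A ∩ (λ t → toℕ⁺ (suc k) + t ∈ A))
    -- By `¬found` the intersection is not large for `r`, so a refinement avoids it.
    ... | inj₁ large′ = ⊥-elim (¬found (_ , ∈B , r , ⊑-trans {r} {q} {p} r⊑q q⊑p , large′))
    ... | inj₂ (r′ , r′⊑r , avoids) = r′ , ⊑-trans {r′} {r} {q} r′⊑r r⊑q , escapes′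
      where
      escapes′ : ∀ {d} → d ∈ B r′ 0 → d ∈ A → d ∈ Escapes (suc k)
      escapes′ {d} d∈B d∈A e e≤ e∈B e+d∈A with ≤-suc-case e≤
      ... | inj₁ e≤k = escapes (r′⊑r 0 d∈B) d∈A e e≤k e∈B e+d∈A
      ... | inj₂ eq  = avoids d∈B
        (d∈A , subst (λ e → e + d ∈ A) (value-injective {e} {toℕ⁺ (suc k)} eq) e+d∈A)

    RB : ℕ → Pred ℕ⁺ 0ℓ
    RB n s = s ∈ B p n × (∃[ a ] ∃[ d ] s ≡ a + d × a ∈ B p n × d ∈ Escapes (n ℕ.+ value a))

    R-avoids : ∀ {s} → s ∈ RB 0 → s ∉ A
    R-avoids (_ , a , d , refl , a∈B , escapes) = escapes a ℕ.≤-refl a∈B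

    R-element : ∀ n → ∃[ s ] s ∈ RB n
    R-element n =
      let a , a∈B           = element p n
          m , a+B⊆B         = absorb p a∈B
          r , r⊑ , escapes  = refine (n ℕ.+ value a) (drop m p) (drop-⊑ m p)
          d , d∈B , d∈A     = large r (⊑-trans {r} {drop m p} {p} r⊑ (drop-⊑ m p))
      in a + d , a+B⊆B (subst (λ m → d ∈ B p m) (ℕ.+-identityʳ m) (r⊑ 0 d∈B)) ,
         a , d , refl , a∈B , escapes d∈B d∈A

    R-absorb : ∀ {n s} → s ∈ RB n → ∃[ m ] (∀ {t} → t ∈ RB m → s + t ∈ RB n)
    -- The summand `m` keeps `s + t` and `s + a` in `B p n`; the summand `n + s` pays for the escape
    -- bound rising from `a` to `s + a`.
    R-absorb {n} {s} (s∈B , _) = n ℕ.+ value s ℕ.+ m , absorbs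
      where
      m = proj₁ (absorb p s∈B)
      s+B⊆B : ∀ {b} → b ∈ B p (n ℕ.+ value s ℕ.+ m) → s + b ∈ B p n
      s+B⊆B b∈B = proj₂ (absorb p s∈B) (B-mono p (ℕ.m≤n+m m (n ℕ.+ value s)) b∈B)
      bound : ∀ a → n ℕ.+ (value s ℕ.+ a) ℕ.≤ n ℕ.+ value s ℕ.+ m ℕ.+ a
      bound a = begin
        n ℕ.+ (value s ℕ.+ a)       ≡⟨ ℕ.+-assoc n (value s) a ⟨
        n ℕ.+ value s ℕ.+ a         ≤⟨ ℕ.+-monoˡ-≤ a (ℕ.m≤m+n _ m) ⟩
        n ℕ.+ value s ℕ.+ m ℕ.+ a   ∎
        where open ℕ.≤-Reasoning
      absorbs : ∀ {t} → t ∈ RB (n ℕ.+ value s ℕ.+ m) → s + t ∈ RB n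
      absorbs (t∈B , a , d , refl , a∈B , escapes) =
        s+B⊆B t∈B , s + a , d , sym (+-assoc s a d) , s+B⊆B a∈B ,
        λ e e≤ → escapes e (ℕ.≤-trans e≤ (bound (value a)))

    R : IdempotentBase
    R = record
      { B       = RB
      ; element = R-element
      ; shrink  = λ n (s∈B , a , d , eq , a∈B , escapes) →
                  shrink p n s∈B , a , d , eq , shrink p n a∈B ,
                  λ e e≤ → escapes e (ℕ.m≤n⇒m≤1+n e≤)
      ; absorb  = R-absorb
      }

  -- A large set contains level 0 of a refinement.

  module _ (p : IdempotentBase) (A : Pred ℕ⁺ 0ℓ) (p-large : Large p A) where

    private
      record Stage : Set₁ where
        field
          base  : IdempotentBase
          X     : Pred ℕ⁺ 0ℓ
          large : Large base X

        translate = large-translate base X large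

        e : ℕ⁺
        e = proj₁ translate

        e∈B : e ∈ B base 0
        e∈B = proj₁ (proj₂ translate)

        depth : ℕ
        -- The `suc` gains one level per stage; thus sums of terms from index `n + k` on reach level
        -- `n` of `base (stage k)`.
        depth = suc (proj₁ (absorb base e∈B))

        refined : IdempotentBase
        refined = proj₁ (proj₂ (proj₂ translate))

        refined⊑base : refined ⊑ base
        refined⊑base = proj₁ (proj₂ (proj₂ (proj₂ translate)))

      open Stage

      next : Stage → Stage
      next S = record
        { base  = drop (depth S) (refined S)
        ; X     = X S ∩ (λ t → e S + t ∈ X S)
        ; large = Large-⊑ {refined S} {drop (depth S) (refined S)} (drop-⊑ (depth S) (refined S))
                    (proj₂ (proj₂ (proj₂ (proj₂ (translate S)))))
        }

      stage : ℕ → Stage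
      stage zero    = record { base = p ; X = A ; large = p-large }
      stage (suc n) = next (stage n)

      es : ℕ → ℕ⁺
      es n = e (stage n)

      Bs : ℕ → ℕ → Pred ℕ⁺ 0ℓ
      Bs n = B (base (stage n))

      Xs : ℕ → Pred ℕ⁺ 0ℓ
      Xs n = X (stage n)

      next-⊆ : ∀ S i → B (base (next S)) i ⊆ B (base S) (suc i)
      next-⊆ S i t∈ = refined⊑base S (suc i)
        (B-mono (refined S) (ℕ.s≤s (ℕ.m≤n+m i _)) t∈)

      next-absorb : ∀ S {t} → t ∈ B (base (next S)) 0 → e S + t ∈ B (base S) 0
      next-absorb S t∈ = proj₂ (absorb (base S) (e∈B S))
        (B-mono (base S) (ℕ.≤-trans (ℕ.n≤1+n _) (ℕ.m≤m+n _ 0)) (refined⊑base S _ t∈))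

      Bs-⊆ : ∀ k n i → Bs (k ℕ.+ n) i ⊆ Bs n (k ℕ.+ i)
      Bs-⊆ zero    n i t∈ = t∈
      Bs-⊆ (suc k) n i {t} t∈ = subst (λ j → t ∈ Bs n j) (ℕ.+-suc k i)
        (Bs-⊆ k n (suc i) (next-⊆ (stage (k ℕ.+ n)) i t∈))

      Sums⊆Bs : ∀ {m n} → Sums es m n ⊆ Bs m 0
      Sums⊆Bs = Sums⊆ (λ n → Bs n 0)
        (λ n t∈ → shrink (base (stage n)) 0 (next-⊆ (stage n) 0 t∈))
        (λ n t∈ → next-absorb (stage n) t∈) (λ n → e∈B (stage n))

      -- The tail Q k of the base generated by Y and the sums refines base (stage k),
      -- hence meets every set that is large there.

      module Tail (Y : ℕ → Pred ℕ⁺ 0ℓ) (Y-anti : ∀ n → Y (suc n) ⊆ Y n)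
                  (Y-shift : ∀ n {t} → t ∈ Y (suc n) → es n + t ∈ Y n)
                  (Y-element : ∀ n → ∃[ s ] (∃[ m ] Sums es n m s) × s ∈ Y n) where

        Q : ℕ → IdempotentBase
        Q k = record
          { B       = λ n s → (∃[ m ] Sums es (n ℕ.+ k) m s) × s ∈ Y (n ℕ.+ k)
          ; element = λ n → Y-element (n ℕ.+ k)
          ; shrink  = λ n ((m , p) , s∈Y) → (m , skipˡ p) , Y-anti (n ℕ.+ k) s∈Y
          ; absorb  = λ ((m , p) , _) → m , λ ((l , q) , t∈Y) →
                      (l , Sums-+ p (Sums-monoˡ (ℕ.m≤m+n m k) q)) ,
                      Sums-shift Y Y-anti Y-shift p (⊆-antitone Y Y-anti (ℕ.m≤m+n m k) t∈Y)
          }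

        Q-⊑ : ∀ k → Q k ⊑ base (stage k)
        Q-⊑ k n {s} ((m , p) , _) =
          subst (λ j → s ∈ Bs k j) (ℕ.+-identityʳ n) (Bs-⊆ n k 0 (Sums⊆Bs p))

      module All = Tail (λ _ → U) (λ _ _ → _) (λ _ _ → _) (λ n → es n , (suc n , here) , _)

      -- The terms `es i` need not lie in `Xs i`. But the sums from index `n` on start a refinement
      -- of `base (stage n)`, and the large set `Xs n` meets it.
      Xs-element : ∀ n → ∃[ s ] (∃[ m ] Sums es n m s) × s ∈ Xs n
      Xs-element n = let s , (p , _) , s∈X = large (stage n) (All.Q n) (All.Q-⊑ n) in s , p , s∈X

      module InX = Tail Xs (λ _ → proj₁) (λ _ → proj₂) Xs-element

    -- Only the sums that fall into `Xs` are kept. They absorb each other by `Sums-shift`, and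
    -- `Xs 0` is `A`.
    large⇒⊆ : ∃[ q ] q ⊑ p × B q 0 ⊆ A
    large⇒⊆ = InX.Q 0 , InX.Q-⊑ 0 , proj₂

  -- Hindman's theorem for bases, diagonal bases and generated filters.

  abstract
    hindman : ∀ k p (P : Fin k → Pred ℕ⁺ 0ℓ) → (∀ {b} → b ∈ B p 0 → ∃[ i ] b ∈ P i) →
              ∃[ q ] ∃[ i ] q ⊑ p × B q 0 ⊆ P i
    hindman k p P covers =
      let q , i , q⊑p , large = large-pigeonhole k p P covers
          r , r⊑q , r⊆P       = large⇒⊆ q (P i) large
      in r , i , ⊑-trans {r} {q} {p} r⊑q q⊑p , r⊆P

  -- From level `n` on the diagonal lies inside `p n`, so it inherits what each `p n` has settled.
  fuse : (p : ℕ → IdempotentBase) → (∀ n → p (suc n) ⊑ p n) → IdempotentBase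
  fuse p p-⊑ = record
    { B       = λ n → B (p n) n
    ; element = λ n → element (p n) n
    ; shrink  = λ n b∈B → shrink (p n) n (p-⊑ n (suc n) b∈B)
    ; absorb  = λ {n} a∈B → let m , a+B⊆B = absorb (p n) a∈B in
                n ℕ.+ m , λ b∈B → a+B⊆B
                  (⊆-antitone (λ i → B (p i) m) (λ i → p-⊑ i m) (ℕ.m≤m+n n m)
                    (B-mono (p (n ℕ.+ m)) (ℕ.m≤n+m m n) b∈B))
    }

  generated : IdempotentBase → IdempotentFilter
  generated p = record
    { members    = λ A → ∃[ n ] B p n ⊆ A
    ; total      = 0 , _
    ; inhabited  = λ (n , B⊆A) → let a , a∈B = element p n in a , B⊆A a∈B
    ; superset   = λ A⊆A′ (n , B⊆A) → n , λ b∈B → A⊆A′ (B⊆A b∈B)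
    ; meet       = λ (m , B⊆A) (n , B⊆A′) → m ℕ.+ n , λ b∈B →
                   B⊆A (B-mono p (ℕ.m≤m+n m n) b∈B) , B⊆A′ (B-mono p (ℕ.m≤n+m n m) b∈B)
    ; idempotent = λ (n , B⊆A) → n , λ a∈B → let m , a+B⊆B = absorb p a∈B in
                   m , λ b∈B → B⊆A (a+B⊆B b∈B)
    }

  -- As the starting point of all refinements, it puts the sets of multiples into every filter
  -- generated later.
  multiplesBase : IdempotentBase
  multiplesBase = record
    { B       = λ n b → ∀ d → value d ℕ.≤ n → value d ∣ value b
    ; element = λ n → toℕ⁺ (n !) {{n ℕ.!≢0}} , λ d d≤n →
                ∣-trans (m∣m! d) (m≤n⇒m!∣n! d≤n)
    ; shrink  = λ n b∈B d d≤n → b∈B d (ℕ.m≤n⇒m≤1+n d≤n)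
    ; absorb  = λ {n} a∈B → n , λ b∈B d d≤n → ∣m∣n⇒∣m+n (a∈B d d≤n) (b∈B d d≤n)
    }
    where
    m∣m! : ∀ (d : ℕ⁺) → value d ∣ value d !
    m∣m! (suc m , _) = m∣m*n (m !)
    m∣m! (zero , [ () ])

  -- Idempotent ultrafilters.

  pigeonhole : ∀ {X : Set} (w : Ultrafilter X) k (P : Fin k → Pred X 0ℓ) →
               (λ x → ∃[ i ] x ∈ P i) ∈ sets w → ∃[ i ] P i ∈ sets w
  pigeonhole w zero    P covers = ⊥-elim (nonempty w (upward w (λ ()) covers))
  pigeonhole w (suc k) P covers with ultra w (P zero)
  ... | inj₁ P∈ = zero , P∈
  ... | inj₂ ∁P∈ =
    let i , P∈ = pigeonhole w k (λ i → P (suc i)) (upward w rest (intersection w ∁P∈ covers))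
    in suc i , P∈
    where
    rest : (∁ (P zero) ∩ (λ x → ∃[ i ] x ∈ P i)) ⊆ (λ x → ∃[ i ] x ∈ P (suc i))
    rest (x∉P , zero  , x∈P) = contradiction x∈P x∉P
    rest (x∉P , suc i , x∈P) = i , x∈P

  module _ (u : Ultrafilter ℕ⁺) (u-idem : AdditivelyIdempotent u) where

    ultrafilter-inhabited : ∀ {A} → A ∈ sets u → ∃[ a ] a ∈ A
    ultrafilter-inhabited {A} A∈ with em 0ℓ {∃[ a ] a ∈ A}
    ... | yes found = found
    ... | no  ¬found = ⊥-elim (nonempty u (upward u (λ a∈A → ¬found (_ , a∈A)) A∈))

    ultrafilter⇒filter : IdempotentFilter
    ultrafilter⇒filter = record
      { members    = sets u
      ; total      = whole u
      ; inhabited  = ultrafilter-inhabited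
      ; superset   = upward u
      ; meet       = intersection u
      ; idempotent = proj₁ u-idem
      }

    -- Some residue class modulo `a` is in `u`. By idempotence, for `u`-many `x` it contains both
    -- `b` and `x + b` for some `b`; subtraction gives divisibility of `x` by `a`.
    multiples∈ultrafilter : ∀ a → (λ b → value a ∣ value b) ∈ sets u
    multiples∈ultrafilter a =
      let i , R∈ = pigeonhole u (value a) Residue (upward u (λ {b} _ → residue b) (whole u)) in
      upward u (λ {x} R+∈ → let b , b∈R , a+b∈R = ultrafilter-inhabited (intersection u R∈ R+∈) in
                        difference i x b b∈R a+b∈R)
               (proj₁ u-idem R∈)
      where
      Residue : Fin (value a) → Pred ℕ⁺ 0ℓ
      Residue i b = ∃[ q ] value b ≡ toℕ i ℕ.+ q ℕ.* value a

      instance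
        a≢0 : NonZero (value a)
        a≢0 = positive a

      residue : ∀ b → ∃[ i ] b ∈ Residue i
      residue b = value b mod value a , value b / value a ,
        trans (m≡m%n+[m/n]*n (value b) (value a))
              (cong (ℕ._+ value b / value a ℕ.* value a) (sym (toℕ-fromℕ< (m%n<n (value b) (value a)))))

      difference : ∀ i x b → b ∈ Residue i → x + b ∈ Residue i → value a ∣ value x
      difference i x b (q , b≡) (r , x+b≡) =
        ∣m+n∣m⇒∣n (divides r (ℕ.+-cancelˡ-≡ (toℕ i) _ _ (begin
          toℕ i ℕ.+ (q ℕ.* value a ℕ.+ value x) ≡⟨ ℕ.+-assoc (toℕ i) _ (value x) ⟨
          toℕ i ℕ.+ q ℕ.* value a ℕ.+ value x   ≡⟨ cong (ℕ._+ value x) b≡ ⟨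
          value b ℕ.+ value x                   ≡⟨ ℕ.+-comm (value b) (value x) ⟩
          value x ℕ.+ value b                   ≡⟨ x+b≡ ⟩
          toℕ i ℕ.+ r ℕ.* value a               ∎))) (n∣m*n q)
        where open ≡-Reasoning

  -- The two claims of the theorem.

  module _ (r : ℕ⁺) (C : FiniteColouring r) where

    idempotent⇒patterns : (u : Ultrafilter ℕ⁺) → AdditivelyIdempotent u →
      ∃[ m ] colour C m ∈ sets (pushforward D (u ⊗ u)) × ContainsPatterns (colour C m)
    idempotent⇒patterns u u-idem =
      let w      = pushforward D (u ⊗ u)
          m , C∈ = pigeonhole w (value r) (colour C) (upward w (λ {n} _ → covers C n) (whole w))
      -- Unfolding `pushforward` and `_⊗_` turns `C∈` into the hypothesis `A∈D`.
      in m , C∈ , D-member⇒ContainsPatterns (ultrafilter⇒filter u u-idem)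
                    (multiples∈ultrafilter u u-idem) (colour C m) C∈

    private
      decide : ∀ a p → ∃[ q ] ∃[ m ] q ⊑ p × B q 0 ⊆ (λ b → D (a , b) ∈ colour C m)
      decide a p = hindman (value r) p (λ m b → D (a , b) ∈ colour C m) (λ {b} _ → covers C (D (a , b)))

      chain : ℕ → IdempotentBase
      chain zero    = multiplesBase
      chain (suc n) = proj₁ (decide (toℕ⁺ (suc n)) (chain n))

      decided : ∀ n → ∃[ m ] chain (suc n) ⊑ chain n ×
                      B (chain (suc n)) 0 ⊆ (λ b → D (toℕ⁺ (suc n) , b) ∈ colour C m)
      decided n = proj₂ (decide (toℕ⁺ (suc n)) (chain n))

      limit : IdempotentBase
      limit = fuse chain (λ n → proj₁ (proj₂ (decided n)))

      limitColour : ∀ a → ∃[ m ] B limit (value a) ⊆ (λ b → D (a , b) ∈ colour C m)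
      -- The number `suc n` is settled by `chain (suc n)`, whose own level `suc n` is that level of
      -- `limit`.
      limitColour (suc n , _) = let m , _ , B⊆ = decided n in
        m , λ b∈B → B⊆ (B-mono (chain (suc n)) ℕ.z≤n b∈B)
      limitColour (zero , [ () ])

      monochromatic : ∃[ q ] ∃[ m ] q ⊑ limit × B q 0 ⊆ (λ a → proj₁ (limitColour a) ≡ m)
      monochromatic = hindman (value r) limit (λ m a → proj₁ (limitColour a) ≡ m) (λ _ → _ , refl)

    patterns : ∃[ m ] ContainsPatterns (colour C m)
    -- Level 0 serves for `a`, all of it having colour `m`; the level for `b` depends on `a` and is
    -- `value a`.
    patterns = m , D-member⇒ContainsPatterns (generated q) multiples (colour C m) (0 , C∈D)
      where
      q   = proj₁ monochromatic
      m   = proj₁ (proj₂ monochromatic)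
      q⊑limit = proj₁ (proj₂ (proj₂ monochromatic))

      limit⊆multiples : ∀ n → B limit n ⊆ B multiplesBase n
      limit⊆multiples n = ⊆-antitone (λ i → B (chain i) n)
        (λ i → proj₁ (proj₂ (decided i)) n) {0} {n} ℕ.z≤n

      multiples : ∀ a → ∃[ n ] B q n ⊆ (λ b → value a ∣ value b)
      multiples a = value a , λ b∈B → limit⊆multiples (value a) (q⊑limit (value a) b∈B) a ℕ.≤-refl

      C∈D : ∀ {a} → a ∈ B q 0 → ∃[ n ] B q n ⊆ (λ b → D (a , b) ∈ colour C m)
      C∈D {a} a∈B = value a , λ {b} b∈B →
        subst (λ m → D (a , b) ∈ colour C m) (proj₂ (proj₂ (proj₂ monochromatic)) a∈B)
              (proj₂ (limitColour a) (q⊑limit (value a) b∈B))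

theorem1p4 : (∀ ℓ → ExcludedMiddle ℓ) → (r : ℕ⁺) (C : FiniteColouring r) →
    (∃[ m ] ContainsPatterns (colour C m)) ×
    ((u : Ultrafilter ℕ⁺) → AdditivelyIdempotent u →
    ∃[ m ] colour C m ∈ sets (pushforward D (u ⊗ u)) × ContainsPatterns (colour C m))
theorem1p4 em r C = patterns em r C , idempotent⇒patterns em r C
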